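{- For every even integer $m\geq 50$, the line graph $L(K_{m,m})$ of the complete bipartite graph $K_{m,m}$ has the PMH--property, i.e. every perfect matching of $L(K_{m,m})$ is contained in some hamiltonian cycle of $L(K_{m,m})$.
   Context: The line graph $L(G)$ has vertex set $E(G)$, two vertices being adjacent when the corresponding edges of $G$ share an end-vertex. A graph has the PMH--property if each of its perfect matchings can be extended to a hamiltonian cycle. -}

module Defs where

open import Data.Nat using (ℕ; suc; _≤_)
open import Data.Fin using (Fin; zero; suc; toℕ; fromℕ; inject₁)
open import Data.Product using (Σ; ∃; ∃-syntax; _×_; _,_; proj₁; proj₂)
open import Data.Sum using (_⊎_; inj₁; inj₂)
open import Relation.Binary.PropositionalEquality using (_≡_; _≢_)
open import Relation.Nullary using (¬_)
open import Function.Definitions using (Injective)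

record Graph : Set₁ where
  field
    V   : Set
    Adj : V → V → Set

open Graph public

-- A graph presented by its edges and their two end-vertices
-- (used to build line graphs, whose vertex set is the edge set).
record IncidenceGraph : Set₁ where
  field
    Vtx : Set
    Edg : Set
    end₁ end₂ : Edg → Vtx

open IncidenceGraph public

IsEnd : (G : IncidenceGraph) → Edg G → Vtx G → Set
IsEnd G e v = (end₁ G e ≡ v) ⊎ (end₂ G e ≡ v)

LineGraph : IncidenceGraph → Graph
LineGraph G = record
  { V   = Edg G
  ; Adj = λ e f → (e ≢ f) × (∃[ v ] (IsEnd G e v × IsEnd G f v)) }

K : ℕ → IncidenceGraph
K m = record
  { Vtx  = Fin m ⊎ Fin m
  ; Edg  = Fin m × Fin m
  ; end₁ = λ e → inj₁ (proj₁ e)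
  ; end₂ = λ e → inj₂ (proj₂ e) }

record PerfectMatching (G : Graph) : Set where
  field
    partner    : V G → V G
    adjacent   : ∀ v → Adj G v (partner v)
    involutive : ∀ v → partner (partner v) ≡ v

open PerfectMatching public

record HamiltonianCycle (G : Graph) : Set where
  field
    k          : ℕ
    long       : 2 ≤ k
    c          : Fin (suc k) → V G
    injective  : Injective _≡_ _≡_ c
    surjective : ∀ v → ∃[ i ] (c i ≡ v)
    step       : ∀ (i : Fin k) → Adj G (c (inject₁ i)) (c (suc i))
    close      : Adj G (c (fromℕ k)) (c zero)

open HamiltonianCycle public

CycleEdge : {G : Graph} → HamiltonianCycle G → V G → V G → Set
CycleEdge H u v =
  (∃[ i ] ((c H (inject₁ i) ≡ u × c H (suc i) ≡ v) ⊎ (c H (inject₁ i) ≡ v × c H (suc i) ≡ u)))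
  ⊎ ((c H (fromℕ (k H)) ≡ u × c H zero ≡ v) ⊎ (c H (fromℕ (k H)) ≡ v × c H zero ≡ u))

PMH : Graph → Set
PMH G = (M : PerfectMatching G) →
  ∃[ H ] (∀ v → CycleEdge {G} H v (partner M v))

{-# OPTIONS --safe #-}
module Submission where

-- A vertex of L(K_{m,m}) is a cell (row, column) of an m × m grid, and adjacent cells share a line (a row or a
-- column); write π for the matching. A Hamiltonian cycle of K_{m,m} with no two consecutive edges matched is a cyclic
-- sequence of 2m cells with a slot on every line: two consecutive unmatched cells on that line. Every other cell z can
-- then be inserted in a slot on the line through z and π z, next to π z if that cell is already present: each insertion
-- leaves a slot on that line, next to every cell still waiting there for its partner.
--
-- Taking every second cell, the cycle of K_{m,m} is a cyclic order of m cells in distinct rows and columns in which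
-- p may precede q unless the cell (row q, column p) is π p or π q. Hence each cell forbids at most one ordered pair.
-- Start from five cells such that no line meets two of the dominoes {y, π y}; they are compatible in any order.
-- A new cell z, in an unused row and column, can always be inserted: two lines pass through z, so at most two
-- of the five forbid a pair containing z, z itself forbids at most two such pairs, and every other cell at most one,
-- which is fewer than the number of places.

open import Defs
open import Data.Nat using (ℕ; _≤_; _*_)
open import Data.Product using (∃-syntax)
open import Relation.Binary.PropositionalEquality using (_≡_)

open import Data.Nat using (zero; suc; _+_; _∸_; _<_; z≤n; s≤s; >-nonZero)
open import Data.Nat.Properties hiding (_≟_)
open import Data.Nat.ListAction using (sum)
open import Data.Nat.ListAction.Properties using (sum-++; sum-↭)
open import Data.Nat.Solver using (module +-*-Solver)
open import Data.Fin as Fin using (Fin; zero; suc; fromℕ; inject₁)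
open import Data.Product using (∃₂; _×_; _,_; proj₁; proj₂)
open import Data.Product.Properties using (≡-dec)
open import Data.Sum as Sum using (_⊎_; inj₁; inj₂; [_,_]′)
open import Data.Sum.Properties using (inj₁-injective; inj₂-injective)
open import Data.List using (List; []; _∷_; _++_; map; length; lookup; concatMap; allFin; cartesianProduct)
open import Data.List.Properties using (length-map; length-++; length-tabulate; map-++; map-cong)
open import Data.List.Relation.Unary.All as All using (All; []; _∷_)
open import Data.List.Relation.Unary.All.Properties using (All¬⇒¬Any; ¬Any⇒All¬; ¬All⇒Any¬)
open import Data.List.Relation.Unary.Any as Any using (Any; here; there)
open import Data.List.Relation.Unary.Any.Properties using (lookup-index)
open import Data.List.Relation.Unary.AllPairs as AllPairs using (AllPairs; []; _∷_)
import Data.List.Relation.Unary.AllPairs.Properties as AllPairsₚ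
open import Data.List.Relation.Unary.Unique.Propositional using (Unique)
open import Data.List.Relation.Unary.Unique.Propositional.Properties using (allFin⁺; cartesianProduct⁺)
open import Data.List.Membership.Propositional using (_∈_; _∉_; find; lose)
open import Data.List.Membership.Propositional.Properties
import Data.List.Membership.DecPropositional as DecMembership
open import Data.List.Relation.Binary.Permutation.Propositional using (_↭_; prep; swap; ↭-refl; ↭-sym; ↭-trans; ↭⇒↭ₛ)
open import Data.List.Relation.Binary.Permutation.Propositional.Properties using (shift; ∈-resp-↭; ↭-length) renaming (map⁺ to ↭-map⁺)
import Data.List.Relation.Binary.Permutation.Setoid.Properties as PermSetoid
open import Relation.Binary.PropositionalEquality using (_≢_; refl; sym; trans; cong; cong₂; subst; setoid; module ≡-Reasoning)
open import Relation.Binary.Definitions using (DecidableEquality)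
open import Relation.Nullary using (¬_; Dec; yes; no; contradiction)
open import Relation.Nullary.Decidable using (¬?)
open import Function using (_∘_; id)

private variable
  A B : Set

-- Lists without repetition and the pigeonhole principle

Unique-resp-↭ : {xs ys : List A} → xs ↭ ys → Unique xs → Unique ys
Unique-resp-↭ p = PermSetoid.Unique-resp-↭ (setoid _) (↭⇒↭ₛ p)

∉⇒All≢ : {x : A} {xs : List A} → x ∉ xs → All (x ≢_) xs
∉⇒All≢ = ¬Any⇒All¬ _

Unique⇒∉ : {x : A} {xs : List A} → Unique (x ∷ xs) → x ∉ xs
Unique⇒∉ (x≢ ∷ _) = All¬⇒¬Any x≢

Unique-map⁻ : (f : A → B) {xs : List A} → Unique (map f xs) → Unique xs
Unique-map⁻ f u = AllPairs.map (λ ne → ne ∘ cong f) (AllPairsₚ.map⁻ u)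

map-injective-on : (f : A → B) {xs : List A} → Unique (map f xs) →
                   ∀ {x y} → x ∈ xs → y ∈ xs → f x ≡ f y → x ≡ y
map-injective-on f u (here refl) (here refl) e = refl
map-injective-on f u (here refl) (there j)   e =
  contradiction (subst (_∈ map f _) (sym e) (∈-map⁺ f j)) (Unique⇒∉ u)
map-injective-on f u (there i) (here refl) e =
  contradiction (subst (_∈ map f _) e (∈-map⁺ f i)) (Unique⇒∉ u)
map-injective-on f (_ ∷ u) (there i) (there j) e = map-injective-on f u i j e

Unique-⊆-length : {xs ys : List A} → Unique xs → (∀ {z} → z ∈ xs → z ∈ ys) → length xs ≤ length ys
Unique-⊆-length {xs = []} u xs⊆ys = z≤n
Unique-⊆-length {xs = x ∷ xs} {ys} u@(_ ∷ u′) xs⊆ys with ∈-∃++ (xs⊆ys (here refl))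
... | as , bs , refl = subst (suc (length xs) ≤_) (sym (↭-length (shift x as bs)))
                             (s≤s (Unique-⊆-length u′ xs⊆rest))
  where
  xs⊆rest : ∀ {z} → z ∈ xs → z ∈ as ++ bs
  xs⊆rest z∈xs with ∈-resp-↭ (shift x as bs) (xs⊆ys (there z∈xs))
  ... | here refl = contradiction z∈xs (Unique⇒∉ u)
  ... | there i   = i

module _ (_≟_ : DecidableEquality A) where
  open DecMembership _≟_ using (_∈?_)

  pigeonhole : {xs ys : List A} → Unique xs → length ys < length xs → ∃[ x ] x ∉ ys
  pigeonhole {xs} {ys} u ys<xs with Any.any? (λ x → ¬? (x ∈? ys)) xs
  ... | yes i = Any.satisfied i
  ... | no ¬i = contradiction (Unique-⊆-length u xs⊆ys) (<⇒≱ ys<xs)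
    where
    xs⊆ys : ∀ {z} → z ∈ xs → z ∈ ys
    xs⊆ys {z} z∈xs with z ∈? ys
    ... | yes j = j
    ... | no ¬j = contradiction (lose z∈xs ¬j) ¬i

  -- An element missing from `xs` could be prepended to it, giving a repetition-free list longer
  -- than `ys`, which contains everything.
  enumerates : {xs ys : List A} → Unique xs → (∀ z → z ∈ ys) → length ys ≤ length xs → ∀ z → z ∈ xs
  enumerates {xs} {ys} u all ys≤xs z with z ∈? xs
  ... | yes z∈xs = z∈xs
  ... | no  z∉xs = contradiction (Unique-⊆-length (∉⇒All≢ z∉xs ∷ u) (λ {y} _ → all y)) (<⇒≱ (s≤s ys≤xs))

-- Closed walks and insertion

-- Arc x t p q: the walk visiting x and then the elements of t has q directly after p.
-- A closed walk has end x t ≡ x, so that t alone lists its vertices.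
data Arc {A : Set} : A → List A → A → A → Set where
  here  : ∀ {x y ys} → Arc x (y ∷ ys) x y
  there : ∀ {x y ys p q} → Arc y ys p q → Arc x (y ∷ ys) p q

end : A → List A → A
end x []       = x
end _ (y ∷ ys) = end y ys

module _ {A : Set} where
  private variable
    x p q z u w : A
    t : List A

  -- Recursion is on the arc, so the insertion happens at the position that the arc marks.
  splice : Arc x t p q → A → List A
  splice (here {y = y} {ys})  z = z ∷ y ∷ ys
  splice (there {y = y} pq) z = y ∷ splice pq z

  splice-end : (pq : Arc x t p q) → end x (splice pq z) ≡ end x t
  splice-end here       = refl
  splice-end (there pq) = splice-end pq

  splice-↭ : (pq : Arc x t p q) → splice pq z ↭ z ∷ t
  splice-↭ here       = ↭-refl
  splice-↭ (there pq) = ↭-trans (prep _ (splice-↭ pq)) (swap _ _ ↭-refl)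

  splice-left : (pq : Arc x t p q) → Arc x (splice pq z) p z
  splice-left here       = here
  splice-left (there pq) = there (splice-left pq)

  splice-right : (pq : Arc x t p q) → Arc x (splice pq z) z q
  splice-right here       = there here
  splice-right (there pq) = there (splice-right pq)

  splice-old : (pq : Arc x t p q) → Arc x t u w → (u ≡ p × w ≡ q) ⊎ Arc x (splice pq z) u w
  splice-old here       here       = inj₁ (refl , refl)
  splice-old here       (there uw) = inj₂ (there (there uw))
  splice-old (there pq) here       = inj₂ here
  splice-old (there pq) (there uw) = Sum.map₂ there (splice-old pq uw)

  splice-new : (pq : Arc x t p q) → Arc x (splice pq z) u w →
               Arc x t u w ⊎ (u ≡ p × w ≡ z) ⊎ (u ≡ z × w ≡ q)
  splice-new here here               = inj₂ (inj₁ (refl , refl))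
  splice-new here (there here)       = inj₂ (inj₂ (refl , refl))
  splice-new here (there (there uw)) = inj₁ (there uw)
  splice-new (there pq) here         = inj₁ here
  splice-new (there pq) (there uw)   = Sum.map₁ there (splice-new pq uw)

  Arc-target : Arc x t p q → q ∈ t
  Arc-target here       = here refl
  Arc-target (there pq) = there (Arc-target pq)

  Arc-source : Arc x t p q → p ≡ x ⊎ p ∈ t
  Arc-source here       = inj₁ refl
  Arc-source (there pq) with Arc-source pq
  ... | inj₁ refl = inj₂ (here refl)
  ... | inj₂ p∈t  = inj₂ (there p∈t)

  end-∈ : ∀ (y : A) ys → end y ys ∈ y ∷ ys
  end-∈ y []       = here refl
  end-∈ y (z ∷ zs) = there (end-∈ z zs)

  predecessor : q ∈ t → ∃[ p ] Arc x t p q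
  predecessor (here refl) = _ , here
  predecessor (there q∈t) = _ , there (proj₂ (predecessor q∈t))

  successor-or-end : p ∈ t → p ≡ end x t ⊎ ∃[ q ] Arc x t p q
  successor-or-end {t = y ∷ []}     (here refl) = inj₁ refl
  successor-or-end {t = y ∷ z ∷ zs} (here refl) = inj₂ (_ , there here)
  successor-or-end {t = y ∷ ys}     (there p∈t) =
    Sum.map₂ (λ (q , pq) → q , there pq) (successor-or-end p∈t)

  end-not-source : Unique (x ∷ t) → Arc x t p q → p ≢ end x t
  end-not-source u       (here {ys = ys}) e = contradiction (subst (_∈ _) (sym e) (end-∈ _ ys)) (Unique⇒∉ u)
  end-not-source (_ ∷ u) (there pq)       e = end-not-source u pq e

  source-∈ : end x t ≡ x → Arc x t p q → p ∈ t
  source-∈ {t = y ∷ ys} closed pq with Arc-source pq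
  ... | inj₁ refl = subst (_∈ y ∷ ys) closed (end-∈ y ys)
  ... | inj₂ p∈t  = p∈t

  successor : end x t ≡ x → p ∈ t → ∃[ q ] Arc x t p q
  successor {x} {y ∷ ys} closed p∈t with successor-or-end {x = x} p∈t
  ... | inj₁ refl = _ , subst (λ v → Arc x (y ∷ ys) v y) (sym closed) here
  ... | inj₂ s    = s

  source-unique : ∀ {p′} → Unique t → Arc x t p q → Arc x t p′ q → p ≡ p′
  source-unique u       here       here        = refl
  source-unique u       here       (there p′q) = contradiction (Arc-target p′q) (Unique⇒∉ u)
  source-unique u       (there pq) here        = contradiction (Arc-target pq) (Unique⇒∉ u)
  source-unique (_ ∷ u) (there pq) (there p′q) = source-unique u pq p′q

  open-target-unique : ∀ {q′} → Unique (x ∷ t) → Arc x t p q → Arc x t p q′ → q ≡ q′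
  open-target-unique u       here       here        = refl
  open-target-unique (_ ∷ u) (there pq) (there pq′) = open-target-unique u pq pq′
  open-target-unique u       here       (there pq′) = contradiction ([ here , there ]′ (Arc-source pq′)) (Unique⇒∉ u)
  open-target-unique u       (there pq) here        = contradiction ([ here , there ]′ (Arc-source pq)) (Unique⇒∉ u)

  -- In a closed walk `x` is also the last entry of `t`, so `x ∷ t` does have a repetition. The
  -- first arc is therefore compared separately: a later arc out of `x` would have to leave the last
  -- place of `t`, which no arc does.
  target-unique : ∀ {q′} → end x t ≡ x → Unique t → Arc x t p q → Arc x t p q′ → q ≡ q′
  target-unique c u here       here        = refl
  target-unique c u here       (there pq′) = contradiction (sym c) (end-not-source u pq′)
  target-unique c u (there pq) here        = contradiction (sym c) (end-not-source u pq)
  target-unique c u (there pq) (there pq′) = open-target-unique u pq pq′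

arc-lookup : ∀ (x : A) t (i : Fin (length t)) → Arc x t (lookup (x ∷ t) (inject₁ i)) (lookup t i)
arc-lookup x (y ∷ ys) zero    = here
arc-lookup x (y ∷ ys) (suc i) = there (arc-lookup y ys i)

arc-index : ∀ {x p q : A} {t} → Arc x t p q → ∃[ i ] (lookup (x ∷ t) (inject₁ i) ≡ p × lookup t i ≡ q)
arc-index here                    = zero , refl , refl
arc-index (there pq) with i , e ← arc-index pq = suc i , e

lookup-end : ∀ (y : A) ys → lookup (y ∷ ys) (fromℕ (length ys)) ≡ end y ys
lookup-end y []       = refl
lookup-end y (z ∷ zs) = lookup-end z zs

lookup-injective : {xs : List A} → Unique xs → ∀ {i j} → lookup xs i ≡ lookup xs j → i ≡ j
lookup-injective {xs = _ ∷ _}  u       {zero}  {zero}  e = refl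
lookup-injective {xs = _ ∷ ys} u       {zero}  {suc j} e = contradiction (subst (_∈ ys) (sym e) (∈-lookup j)) (Unique⇒∉ u)
lookup-injective {xs = _ ∷ ys} u       {suc i} {zero}  e = contradiction (subst (_∈ ys) e (∈-lookup i)) (Unique⇒∉ u)
lookup-injective {xs = _ ∷ _}  (_ ∷ u) {suc i} {suc j} e = cong suc (lookup-injective u e)

-- Counting by weights

⟦_⟧ : {P : Set} → Dec P → ℕ
⟦ yes _ ⟧ = 1
⟦ no _ ⟧  = 0

⟦⟧-mono : {P Q : Set} (P? : Dec P) (Q? : Dec Q) → (P → Q) → ⟦ P? ⟧ ≤ ⟦ Q? ⟧
⟦⟧-mono (yes p) (yes q) f = ≤-refl
⟦⟧-mono (yes p) (no ¬q) f = contradiction (f p) ¬q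
⟦⟧-mono (no ¬p) Q?      f = z≤n

⟦⟧-exclusive : {P Q : Set} (P? : Dec P) (Q? : Dec Q) → (P → ¬ Q) → ⟦ P? ⟧ + ⟦ Q? ⟧ ≤ 1
⟦⟧-exclusive (yes p) (yes q) f = contradiction q (f p)
⟦⟧-exclusive (yes p) (no ¬q) f = ≤-refl
⟦⟧-exclusive (no ¬p) (yes q) f = ≤-refl
⟦⟧-exclusive (no ¬p) (no ¬q) f = z≤n

⟦⟧≡0⇒¬ : {P : Set} (P? : Dec P) → ⟦ P? ⟧ ≡ 0 → ¬ P
⟦⟧≡0⇒¬ (no ¬p) _ = ¬p

weight : (A → ℕ) → List A → ℕ
weight h xs = sum (map h xs)

weight-+ : (f g : A → ℕ) (xs : List A) → weight (λ x → f x + g x) xs ≡ weight f xs + weight g xs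
weight-+ f g []       = refl
weight-+ f g (x ∷ xs) = trans (cong (f x + g x +_) (weight-+ f g xs))
  (solve 4 (λ a b c d → a :+ b :+ (c :+ d) := a :+ c :+ (b :+ d)) refl (f x) (g x) (weight f xs) (weight g xs))
  where open +-*-Solver

weight-mono : (f g : A → ℕ) (xs : List A) → (∀ {x} → x ∈ xs → f x ≤ g x) → weight f xs ≤ weight g xs
weight-mono f g []       f≤g = z≤n
weight-mono f g (x ∷ xs) f≤g = +-mono-≤ (f≤g (here refl)) (weight-mono f g xs (f≤g ∘ there))

weight-≤-length : (f : A → ℕ) (xs : List A) → (∀ {x} → x ∈ xs → f x ≤ 1) → weight f xs ≤ length xs
weight-≤-length f []       f≤1 = z≤n
weight-≤-length f (x ∷ xs) f≤1 = +-mono-≤ (f≤1 (here refl)) (weight-≤-length f xs (f≤1 ∘ there))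

weight-fibre : (_≟_ : DecidableEquality B) (φ : A → B) (b : B) (xs : List A) →
               Unique (map φ xs) → weight (λ x → ⟦ b ≟ φ x ⟧) xs ≤ 1
weight-fibre _≟_ φ b []       u = z≤n
weight-fibre {B} {A} _≟_ φ b (x ∷ xs) u@(_ ∷ u′) with b ≟ φ x
... | no _     = weight-fibre _≟_ φ b xs u′
... | yes refl = s≤s (≤-reflexive (vanish xs (Unique⇒∉ u)))
  where
  vanish : ∀ ys → φ x ∉ map φ ys → weight (λ y → ⟦ φ x ≟ φ y ⟧) ys ≡ 0
  vanish []       _   = refl
  vanish (y ∷ ys) φx∉ with φ x ≟ φ y
  ... | yes e = contradiction (here e) φx∉
  ... | no _  = vanish ys (φx∉ ∘ there)

module _ (f g : A → ℕ) where
  private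
    h : A → ℕ
    h x = f x + g x

  FreeArc : A → List A → Set
  FreeArc x t = ∃₂ λ p q → Arc x t p q × f p + g q ≡ 0

  -- If no arc is free, each of the `length t` arcs `p q` has `f p + g q` at least 1. Summing, `g`
  -- is taken once at every entry of `t`, while `f` is taken at `x` and at every entry except the
  -- last; this accounts for the two boundary terms.
  free-arc-or-heavy : ∀ x t → FreeArc x t ⊎ (length t + f (end x t) ≤ f x + weight h t)
  free-arc-or-heavy x []       = inj₂ (≤-reflexive (sym (+-identityʳ (f x))))
  free-arc-or-heavy x (y ∷ ys) with f x + g y in e | free-arc-or-heavy y ys
  ... | zero  | _                         = inj₁ (x , y , here , e)
  ... | suc _ | inj₁ (p , q , pq , pq≡0) = inj₁ (p , q , there pq , pq≡0)
  ... | suc n | inj₂ le                  = inj₂ (begin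
    suc (length ys + f (end y ys))    ≤⟨ s≤s le ⟩
    suc (f y + weight h ys)           ≤⟨ s≤s (m≤n+m _ n) ⟩
    suc n + (f y + weight h ys)       ≡⟨ cong (_+ (f y + weight h ys)) (sym e) ⟩
    f x + g y + (f y + weight h ys)   ≡⟨ solve 4 (λ a b c d → a :+ b :+ (c :+ d) := a :+ (c :+ b :+ d)) refl
                                           (f x) (g y) (f y) (weight h ys) ⟩
    f x + (f y + g y + weight h ys)   ∎)
    where open ≤-Reasoning
          open +-*-Solver

  -- On a closed walk the two boundary terms coincide and cancel.
  free-arc : ∀ {x t} → end x t ≡ x → weight h t < length t → FreeArc x t
  free-arc {x} {t} closed light with free-arc-or-heavy x t
  ... | inj₁ a  = a
  ... | inj₂ le = contradiction (+-cancelʳ-≤ (f x) _ _ le′) (<⇒≱ light)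
    where
    le′ : length t + f x ≤ weight h t + f x
    le′ = ≤-trans (subst (λ v → length t + f v ≤ f x + weight h t) closed le) (≤-reflexive (+-comm (f x) _))

length-concatMap : (f : A → List B) (n : ℕ) → (∀ x → length (f x) ≡ n) →
                   ∀ xs → length (concatMap f xs) ≡ length xs * n
length-concatMap f n eq []       = refl
length-concatMap f n eq (x ∷ xs) =
  trans (length-++ (f x)) (cong₂ _+_ (eq x) (length-concatMap f n eq xs))

length-cartesianProduct : (xs : List A) (ys : List B) → length (cartesianProduct xs ys) ≡ length xs * length ys
length-cartesianProduct []       ys = refl
length-cartesianProduct (x ∷ xs) ys = trans (length-++ (map (x ,_) ys))
  (cong₂ _+_ (length-map (x ,_) ys) (length-cartesianProduct xs ys))

length-allFin : ∀ n → length (allFin n) ≡ n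
length-allFin n = length-tabulate {n = n} id

-- Cells and lines of the grid

module Grid {m : ℕ} (M : PerfectMatching (LineGraph (K m))) where

  Cell Line : Set
  Cell = Fin m × Fin m
  Line = Fin m ⊎ Fin m

  row col : Cell → Fin m
  row = proj₁
  col = proj₂

  On : Cell → Line → Set
  On = IsEnd (K m)

  π : Cell → Cell
  π = partner M

  π-involutive : ∀ x → π (π x) ≡ x
  π-involutive = involutive M

  π-≢ : ∀ x → x ≢ π x
  π-≢ x = proj₁ (adjacent M x)

  mate-line : ∀ x → ∃[ v ] (On x v × On (π x) v)
  mate-line x = proj₂ (adjacent M x)

  _≟_ : DecidableEquality Cell
  _≟_ = ≡-dec Fin._≟_ Fin._≟_

  open DecMembership _≟_ using (_∈?_)

  line-unique : ∀ {x y v w} → x ≢ y → On x v → On y v → On x w → On y w → v ≡ w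
  line-unique x≢y (inj₁ refl) _           (inj₁ refl) _           = refl
  line-unique x≢y (inj₂ refl) _           (inj₂ refl) _           = refl
  line-unique x≢y (inj₁ refl) (inj₁ refl) (inj₂ refl) (inj₂ refl) = contradiction refl x≢y
  line-unique x≢y (inj₂ refl) (inj₂ refl) (inj₁ refl) (inj₁ refl) = contradiction refl x≢y

  cells : List Cell
  cells = cartesianProduct (allFin m) (allFin m)

  cells-unique : Unique cells
  cells-unique = cartesianProduct⁺ (allFin⁺ m) (allFin⁺ m)

  length-cells : length cells ≡ m * m
  length-cells = trans (length-cartesianProduct (allFin m) (allFin m)) (cong₂ _*_ (length-allFin m) (length-allFin m))

  cellsOn : Line → List Cell
  cellsOn (inj₁ a) = map (a ,_) (allFin m)
  cellsOn (inj₂ b) = map (_, b) (allFin m)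

  length-cellsOn : ∀ v → length (cellsOn v) ≡ m
  length-cellsOn (inj₁ a) = trans (length-map (a ,_) (allFin m)) (length-allFin m)
  length-cellsOn (inj₂ b) = trans (length-map (_, b) (allFin m)) (length-allFin m)

  ∈-cellsOn : ∀ {x v} → On x v → x ∈ cellsOn v
  ∈-cellsOn (inj₁ refl) = ∈-map⁺ _ (∈-allFin _)
  ∈-cellsOn (inj₂ refl) = ∈-map⁺ _ (∈-allFin _)

  -- Dominoes that no line joins

  Touches : Cell → Line → Set
  Touches x v = On x v ⊎ On (π x) v

  Near : Cell → Cell → Set
  Near x y = ∃[ v ] (Touches x v × Touches y v)

  Far : Cell → Cell → Set
  Far x y = ¬ Near x y

  linesOf : Cell → List Line
  linesOf y = inj₁ (row y) ∷ inj₂ (col y) ∷ inj₁ (row (π y)) ∷ inj₂ (col (π y)) ∷ []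

  ∈-linesOf : ∀ {y v} → Touches y v → v ∈ linesOf y
  ∈-linesOf (inj₁ (inj₁ e)) = here (sym e)
  ∈-linesOf (inj₁ (inj₂ e)) = there (here (sym e))
  ∈-linesOf (inj₂ (inj₁ e)) = there (there (here (sym e)))
  ∈-linesOf (inj₂ (inj₂ e)) = there (there (there (here (sym e))))

  nearby : List Cell → List Cell
  nearby ys = concatMap cellsOn (concatMap linesOf ys)

  length-nearby : ∀ ys → length (nearby ys) ≡ length ys * 4 * m
  length-nearby ys = trans (length-concatMap cellsOn m length-cellsOn (concatMap linesOf ys))
    (cong (_* m) (length-concatMap linesOf 4 (λ _ → refl) ys))

  ∈-nearby : ∀ {ys y z v} → y ∈ ys → Touches y v → On z v → z ∈ nearby ys
  ∈-nearby y∈ys yv zv =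
    ∈-concatMap⁺ cellsOn (lose (∈-concatMap⁺ linesOf (lose y∈ys (∈-linesOf yv))) (∈-cellsOn zv))

  -- The domino of each `y` meets at most four lines, covering at most 4m cells. Both `x` and `π x`
  -- must avoid these, so each `y` spoils at most 8m of the m² choices of `x`.
  far-cell : ∀ ys → length ys * 8 < m → ∃[ x ] All (Far x) ys
  far-cell ys small = proj₁ fresh , All.tabulate (far (proj₂ fresh))
    where
    bad : List Cell
    bad = nearby ys ++ map π (nearby ys)
    length-bad : length bad ≡ length ys * 8 * m
    length-bad = begin
      length bad                                         ≡⟨ length-++ (nearby ys) ⟩
      length (nearby ys) + length (map π (nearby ys))    ≡⟨ cong (length (nearby ys) +_) (length-map π (nearby ys)) ⟩
      length (nearby ys) + length (nearby ys)            ≡⟨ cong (λ n → n + n) (length-nearby ys) ⟩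
      length ys * 4 * m + length ys * 4 * m              ≡⟨ solve 2 (λ a b → a :* con 4 :* b :+ a :* con 4 :* b := a :* con 8 :* b) refl (length ys) m ⟩
      length ys * 8 * m                                  ∎
      where open ≡-Reasoning
            open +-*-Solver
    bad<cells : length bad < length cells
    bad<cells = begin-strict
      length bad          ≡⟨ length-bad ⟩
      length ys * 8 * m   <⟨ *-monoˡ-< m {{>-nonZero (≤-<-trans z≤n small)}} small ⟩
      m * m               ≡⟨ sym length-cells ⟩
      length cells        ∎
      where open ≤-Reasoning
    fresh : ∃[ x ] x ∉ bad
    fresh = pigeonhole _≟_ cells-unique bad<cells
    far : ∀ {x y} → x ∉ bad → y ∈ ys → Far x y
    far x∉ y∈ys (v , inj₁ xv , yv)      = x∉ (∈-++⁺ˡ (∈-nearby y∈ys yv xv))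
    far {x} x∉ y∈ys (v , inj₂ πxv , yv) =
      x∉ (∈-++⁺ʳ (nearby ys) (subst (_∈ map π (nearby ys)) (π-involutive x) (∈-map⁺ π (∈-nearby y∈ys yv πxv))))

  far-cells : ∀ n → n * 8 ≤ m → ∃[ ys ] (length ys ≡ n × AllPairs Far ys)
  far-cells zero    _   = [] , refl , []
  far-cells (suc n) n≤m = proj₁ new ∷ ys , cong suc length-ys , proj₂ new ∷ ys-far
    where
    rec : ∃[ ys ] (length ys ≡ n × AllPairs Far ys)
    rec = far-cells n (≤-trans (m≤n+m (n * 8) 8) n≤m)
    ys : List Cell
    ys = proj₁ rec
    length-ys : length ys ≡ n
    length-ys = proj₁ (proj₂ rec)
    ys-far : AllPairs Far ys
    ys-far = proj₂ (proj₂ rec)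
    new : ∃[ x ] All (Far x) ys
    new = far-cell ys (subst (λ l → l * 8 < m) (sym length-ys) (≤-trans (s≤s (m≤n+m (n * 8) 7)) n≤m))

  -- Compatible cyclic orders

  link : Cell → Cell → Cell
  link p q = row q , col p

  -- p → q stands for the path  row p – col p – row q – col q  of K m m; the cell of its middle edge is link p q.
  record Compatible (p q : Cell) : Set where
    field
      row≢  : row p ≢ row q
      col≢  : col p ≢ col q
      πsrc≢ : π p ≢ link p q
      πtgt≢ : π q ≢ link p q
  open Compatible

  -- Every failure puts a cell of one domino on a line of the other: `link p q` lies in the row of
  -- `q` and in the column of `p`.
  far⇒compatible : ∀ {p q} → Far p q → Compatible p q
  far⇒compatible far = record
    { row≢  = λ e → far (_ , inj₁ (inj₁ (cong inj₁ e)) , inj₁ (inj₁ refl))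
    ; col≢  = λ e → far (_ , inj₁ (inj₂ (cong inj₂ e)) , inj₁ (inj₂ refl))
    ; πsrc≢ = λ e → far (_ , inj₂ (inj₁ (cong (inj₁ ∘ row) e)) , inj₁ (inj₁ refl))
    ; πtgt≢ = λ e → far (_ , inj₁ (inj₂ refl) , inj₂ (inj₂ (cong (inj₂ ∘ col) e)))
    }

  Near-sym : ∀ {p q} → Near p q → Near q p
  Near-sym (v , pv , qv) = v , qv , pv

  far-unique : ∀ {ys} → AllPairs Far ys →
               (φ : Cell → Fin m) → (∀ {p q} → φ p ≡ φ q → Near p q) → Unique (map φ ys)
  far-unique far φ near = AllPairsₚ.map⁺ (AllPairs.map (λ ¬pq e → ¬pq (near e)) far)

  -- `⊇base` keeps the pairwise far cells in view, since their smaller total weight is what makes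
  -- every extension possible.
  record CompatibleWalk (base : List Cell) (x : Cell) (t : List Cell) : Set where
    field
      closed  : end x t ≡ x
      rows    : Unique (map row t)
      cols    : Unique (map col t)
      good    : ∀ {p q} → Arc x t p q → Compatible p q
      ⊇base   : ∃[ rest ] t ↭ base ++ rest

  module Extend {base : List Cell} (base-far : AllPairs Far base) (base≥5 : 5 ≤ length base)
                {x : Cell} {t : List Cell} (W : CompatibleWalk base x t) {z : Cell}
                (new-row : row z ∉ map row t) (new-col : col z ∉ map col t) where
    open CompatibleWalk W

    row-≢ : ∀ {p} → p ∈ t → row p ≢ row z
    row-≢ p∈t e = new-row (subst (_∈ map row t) e (∈-map⁺ row p∈t))

    col-≢ : ∀ {p} → p ∈ t → col p ≢ col z
    col-≢ p∈t e = new-col (subst (_∈ map col t) e (∈-map⁺ col p∈t))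

    -- Placing `p` directly before `z` can be forbidden by `p` (`self-out`) or by `z` (`new-out`);
    -- placing `z` directly before `q`, by `q` (`self-in`) or by `z` (`new-in`). These are grouped
    -- below by side of `z`, to find a free arc, and by forbidding cell, to count.
    self-out self-in new-out new-in : Cell → ℕ
    self-out p = ⟦ π p ≟ link p z ⟧
    self-in  q = ⟦ π q ≟ link z q ⟧
    new-out  p = ⟦ π z ≟ link p z ⟧
    new-in   q = ⟦ π z ≟ link z q ⟧

    out in′ self new : Cell → ℕ
    out  p = self-out p + new-out p
    in′  q = self-in q + new-in q
    self p = self-out p + self-in p
    new  p = new-out p + new-in p

    -- The two harmful positions of `π p` lie in different rows, that of `z` and that of `p`.
    self≤1 : ∀ {p} → p ∈ t → self p ≤ 1
    self≤1 {p} p∈t = ⟦⟧-exclusive (π p ≟ link p z) (π p ≟ link z p)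
      (λ e e′ → row-≢ p∈t (cong row (trans (sym e′) e)))

    fibre-sum : (f g : Cell → ℕ) (φ ψ : Cell → Fin m) (a b : Fin m) (xs : List Cell) →
                Unique (map φ xs) → Unique (map ψ xs) →
                (∀ p → f p ≤ ⟦ a Fin.≟ φ p ⟧) → (∀ p → g p ≤ ⟦ b Fin.≟ ψ p ⟧) →
                weight (λ p → f p + g p) xs ≤ 2
    fibre-sum f g φ ψ a b xs uφ uψ f≤ g≤ = begin
      weight (λ p → f p + g p) xs  ≡⟨ weight-+ f g xs ⟩
      weight f xs + weight g xs    ≤⟨ +-mono-≤ (weight-mono f _ xs (λ _ → f≤ _)) (weight-mono g _ xs (λ _ → g≤ _)) ⟩
      weight (λ p → ⟦ a Fin.≟ φ p ⟧) xs + weight (λ p → ⟦ b Fin.≟ ψ p ⟧) xs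
                                   ≤⟨ +-mono-≤ (weight-fibre Fin._≟_ φ a xs uφ) (weight-fibre Fin._≟_ ψ b xs uψ) ⟩
      2                            ∎
      where open ≤-Reasoning

    -- `π z ≡ link p z` determines the column of `p`, and `π z ≡ link z p` its row; rows and columns
    -- are distinct along `t`.
    new≤2 : weight new t ≤ 2
    new≤2 = fibre-sum new-out new-in col row (col (π z)) (row (π z)) t cols rows
      (λ p → ⟦⟧-mono _ _ (cong col)) (λ p → ⟦⟧-mono _ _ (cong row))

    -- A harmful `π p` lies in the row or in the column of `z`. Far cells have partners in distinct
    -- rows and distinct columns, so each of these two lines accounts for at most one base cell.
    self-base≤2 : weight self base ≤ 2
    self-base≤2 = fibre-sum self-out self-in (row ∘ π) (col ∘ π) (row z) (col z) base
      (far-unique base-far (row ∘ π) (λ e → _ , inj₂ (inj₁ (cong inj₁ e)) , inj₂ (inj₁ refl)))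
      (far-unique base-far (col ∘ π) (λ e → _ , inj₂ (inj₂ (cong inj₂ e)) , inj₂ (inj₂ refl)))
      (λ p → ⟦⟧-mono _ _ (sym ∘ cong row)) (λ p → ⟦⟧-mono _ _ (sym ∘ cong col))

    light : weight (λ p → out p + in′ p) t < length t
    light with ⊇base
    ... | rest , t↭ = begin-strict
      weight (λ p → out p + in′ p) t                  ≡⟨ cong sum (map-cong regroup t) ⟩
      weight (λ p → self p + new p) t                 ≡⟨ weight-+ self new t ⟩
      weight self t + weight new t                    ≤⟨ +-monoʳ-≤ (weight self t) new≤2 ⟩
      weight self t + 2                               ≡⟨ cong (_+ 2) (sum-↭ (↭-map⁺ self t↭)) ⟩
      weight self (base ++ rest) + 2                  ≡⟨ cong (λ l → sum l + 2) (map-++ self base rest) ⟩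
      sum (map self base ++ map self rest) + 2        ≡⟨ cong (_+ 2) (sum-++ (map self base) (map self rest)) ⟩
      weight self base + weight self rest + 2         ≤⟨ +-monoˡ-≤ 2 (+-mono-≤ self-base≤2 (weight-≤-length self rest self-rest≤1)) ⟩
      2 + length rest + 2                             ≡⟨ +-comm (2 + length rest) 2 ⟩
      -- The base and `z` account for at most 2 each, so five base cells leave an arc to spare.
      4 + length rest                                 <⟨ +-monoˡ-≤ (length rest) base≥5 ⟩
      length base + length rest                       ≡⟨ sym (length-++ base) ⟩
      length (base ++ rest)                           ≡⟨ sym (↭-length t↭) ⟩
      length t                                        ∎
      where
      open ≤-Reasoning
      self-rest≤1 : ∀ {p} → p ∈ rest → self p ≤ 1
      self-rest≤1 p∈ = self≤1 (∈-resp-↭ (↭-sym t↭) (∈-++⁺ʳ base p∈))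
      regroup : ∀ p → out p + in′ p ≡ self p + new p
      regroup p = solve 4 (λ a b c d → a :+ b :+ (c :+ d) := a :+ c :+ (b :+ d)) refl
                    (self-out p) (new-out p) (self-in p) (new-in p)
        where open +-*-Solver

    extend : ∃[ t′ ] (t′ ↭ z ∷ t × CompatibleWalk base x t′)
    extend with free-arc out in′ closed light
    ... | p , q , pq , free = splice pq z , splice-↭ pq , record
      { closed = trans (splice-end pq) closed
      ; rows   = Unique-resp-↭ (↭-map⁺ row (↭-sym (splice-↭ pq))) (∉⇒All≢ new-row ∷ rows)
      ; cols   = Unique-resp-↭ (↭-map⁺ col (↭-sym (splice-↭ pq))) (∉⇒All≢ new-col ∷ cols)
      ; good   = good′ ∘ splice-new pq
      ; ⊇base  = z ∷ proj₁ ⊇base , ↭-trans (splice-↭ pq)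
                   (↭-trans (prep z (proj₂ ⊇base)) (↭-sym (shift z base (proj₁ ⊇base))))
      }
      where
      out≡0 : out p ≡ 0
      out≡0 = m+n≡0⇒m≡0 (out p) free
      in≡0 : in′ q ≡ 0
      in≡0 = m+n≡0⇒n≡0 (out p) free
      p∈t : p ∈ t
      p∈t = source-∈ closed pq
      q∈t : q ∈ t
      q∈t = Arc-target pq
      good′ : ∀ {u w} → Arc x t u w ⊎ (u ≡ p × w ≡ z) ⊎ (u ≡ z × w ≡ q) → Compatible u w
      good′ (inj₁ uw)                   = good uw
      good′ (inj₂ (inj₁ (refl , refl))) = record
        { row≢  = row-≢ p∈t
        ; col≢  = col-≢ p∈t
        ; πsrc≢ = ⟦⟧≡0⇒¬ _ (m+n≡0⇒m≡0 (self-out p) out≡0)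
        ; πtgt≢ = ⟦⟧≡0⇒¬ _ (m+n≡0⇒n≡0 (self-out p) out≡0)
        }
      good′ (inj₂ (inj₂ (refl , refl))) = record
        { row≢  = row-≢ q∈t ∘ sym
        ; col≢  = col-≢ q∈t ∘ sym
        ; πsrc≢ = ⟦⟧≡0⇒¬ _ (m+n≡0⇒n≡0 (self-in q) in≡0)
        ; πtgt≢ = ⟦⟧≡0⇒¬ _ (m+n≡0⇒m≡0 (self-in q) in≡0)
        }

  spanning : ∀ {base} → AllPairs Far base → 5 ≤ length base → ∀ n {x t} →
             CompatibleWalk base x t → n + length t ≡ m → ∃[ t′ ] (length t′ ≡ m × CompatibleWalk base x t′)
  spanning far ≥5 zero    {t = t} W e = t , e , W
  spanning {base} far ≥5 (suc n) {x} {t} W e = spanning far ≥5 n (proj₂ (proj₂ longer)) (begin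
    n + length (proj₁ longer)  ≡⟨ cong (n +_) (↭-length (proj₁ (proj₂ longer))) ⟩
    n + suc (length t)         ≡⟨ +-suc n (length t) ⟩
    suc n + length t           ≡⟨ e ⟩
    m                          ∎)
    where
    open ≡-Reasoning
    short : (f : Cell → Fin m) → length (map f t) < length (allFin m)
    short f = subst (_< _) (sym (length-map f t))
      (subst (length t <_) (trans e (sym (length-allFin m))) (s≤s (m≤n+m (length t) n)))
    fresh : (f : Cell → Fin m) → ∃[ i ] i ∉ map f t
    fresh f = pigeonhole Fin._≟_ (allFin⁺ m) (short f)
    z : Cell
    z = proj₁ (fresh row) , proj₁ (fresh col)
    longer : ∃[ t′ ] (t′ ↭ z ∷ t × CompatibleWalk base x t′)
    longer = Extend.extend far ≥5 W (proj₂ (fresh row)) (proj₂ (fresh col))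

  five-cycle : ∀ {a b c d e} → let ys = a ∷ b ∷ c ∷ d ∷ e ∷ [] in AllPairs Far ys → CompatibleWalk ys e ys
  five-cycle {a} {b} {c} {d} {e} far@((ab ∷ _ ∷ _ ∷ ae ∷ []) ∷ (bc ∷ _) ∷ (cd ∷ _) ∷ (de ∷ []) ∷ _) = record
    { closed = refl
    ; rows   = far-unique far row (λ {p} p≡q → inj₁ (row p) , inj₁ (inj₁ refl) , inj₁ (inj₁ (cong inj₁ (sym p≡q))))
    ; cols   = far-unique far col (λ {p} p≡q → inj₂ (col p) , inj₁ (inj₂ refl) , inj₁ (inj₂ (cong inj₂ (sym p≡q))))
    ; good   = good′
    ; ⊇base  = [] , ↭-refl
    }
    where
    good′ : ∀ {p q} → Arc e (a ∷ b ∷ c ∷ d ∷ e ∷ []) p q → Compatible p q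
    -- The closing arc runs from `e` back to `a`, against the list order, hence the symmetry.
    good′ here                                 = far⇒compatible (ae ∘ Near-sym)
    good′ (there here)                         = far⇒compatible ab
    good′ (there (there here))                 = far⇒compatible bc
    good′ (there (there (there here)))         = far⇒compatible cd
    good′ (there (there (there (there here)))) = far⇒compatible de

  -- The bound 40 is 5 times 8: five far cells, at 8m spoiled choices each.
  compatible-cycle : 40 ≤ m → ∃₂ λ base x → ∃[ t ] (length t ≡ m × CompatibleWalk base x t)
  compatible-cycle 40≤m = grow (far-cells 5 40≤m)
    where
    grow : ∃[ ys ] (length ys ≡ 5 × AllPairs Far ys) → ∃₂ λ base x → ∃[ t ] (length t ≡ m × CompatibleWalk base x t)
    grow (ys@(a ∷ b ∷ c ∷ d ∷ e ∷ []) , _ , far) =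
      ys , e , spanning far ≤-refl (m ∸ 5) (five-cycle far) (m∸n+n≡m (≤-trans (m≤m+n 5 35) 40≤m))

  -- Walks with slots, and the first one, from a compatible order

  record Slot (x : Cell) (t : List Cell) (v : Line) (p q : Cell) : Set where
    field
      arc       : Arc x t p q
      src-on    : On p v
      tgt-on    : On q v
      unmatched : π p ≢ q

  -- The invariant of the insertion process. `slots` lets a cell enter before its partner, `pending`
  -- reserves a place beside a cell whose partner is absent, and `settled` becomes the covering of
  -- the matching once all cells are present.
  record CellWalk (x : Cell) (t : List Cell) : Set where
    field
      closed  : end x t ≡ x
      unique  : Unique t
      linked  : ∀ {p q} → Arc x t p q → Adj (LineGraph (K m)) p q
      slots   : ∀ v → ∃₂ λ p q → Slot x t v p q
      pending : ∀ {y v} → y ∈ t → π y ∉ t → On y v → On (π y) v →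
                ∃₂ λ p q → Slot x t v p q × (p ≡ y ⊎ q ≡ y)
      settled : ∀ {y} → y ∈ t → π y ∈ t → Arc x t y (π y) ⊎ Arc x t (π y) y

  -- Restores the omitted edges of the cycle of `K m`: `link p q` is the edge joining the column end
  -- of `p` to the row end of `q`.
  expand : Cell → List Cell → List Cell
  expand p []      = []
  expand p (q ∷ t) = link p q ∷ q ∷ expand q t

  expand-end : ∀ p t → end p (expand p t) ≡ end p t
  expand-end p []      = refl
  expand-end p (q ∷ t) = expand-end q t

  expand-in : ∀ {p t a b} → Arc p t a b → Arc p (expand p t) a (link a b)
  expand-in here       = here
  expand-in (there ab) = there (there (expand-in ab))

  expand-out : ∀ {p t a b} → Arc p t a b → Arc p (expand p t) (link a b) b
  expand-out here       = there here
  expand-out (there ab) = there (there (expand-out ab))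

  expand-arc⁻ : ∀ {p t u w} → Arc p (expand p t) u w →
                ∃₂ λ a b → Arc p t a b × ((u ≡ a × w ≡ link a b) ⊎ (u ≡ link a b × w ≡ b))
  expand-arc⁻ {t = q ∷ t} here               = _ , _ , here , inj₁ (refl , refl)
  expand-arc⁻ {t = q ∷ t} (there here)       = _ , _ , here , inj₂ (refl , refl)
  expand-arc⁻ {t = q ∷ t} (there (there uw)) with a , b , ab , e ← expand-arc⁻ uw = a , b , there ab , e

  expand-∈⁻ : ∀ {p t y} → y ∈ expand p t → ∃₂ λ a b → Arc p t a b × (y ≡ link a b ⊎ y ≡ b)
  expand-∈⁻ {t = q ∷ t} (here refl)         = _ , _ , here , inj₁ refl
  expand-∈⁻ {t = q ∷ t} (there (here refl)) = _ , _ , here , inj₂ refl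
  expand-∈⁻ {t = q ∷ t} (there (there y∈))  with a , b , ab , e ← expand-∈⁻ y∈ = a , b , there ab , e

  expand-row : ∀ {p t y} → y ∈ expand p t → row y ∈ map row t
  expand-row y∈ with expand-∈⁻ y∈
  ... | _ , _ , ab , inj₁ refl = ∈-map⁺ row (Arc-target ab)
  ... | _ , _ , ab , inj₂ refl = ∈-map⁺ row (Arc-target ab)

  -- Each step adds `link p q` and `q`, both in the row of `q`, which no later step uses; the two
  -- differ in column.
  expand-unique : ∀ {p t} → (∀ {a b} → Arc p t a b → Compatible a b) → Unique (map row t) → Unique (expand p t)
  expand-unique {t = []}    good u = []
  expand-unique {p} {q ∷ t} good u@(_ ∷ u′) =
    (col≢ (good here) ∘ cong col ∷ ∉⇒All≢ (new refl)) ∷ ∉⇒All≢ (new refl) ∷ expand-unique (good ∘ there) u′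
    where
    new : ∀ {y} → row y ≡ row q → y ∉ expand q t
    new e y∈ = Unique⇒∉ u (subst (_∈ map row t) e (expand-row y∈))

  module Expand {base : List Cell} {x : Cell} {t : List Cell} (W : CompatibleWalk base x t) (length-t : length t ≡ m) where
    open CompatibleWalk W

    t-unique : Unique t
    t-unique = Unique-map⁻ row rows

    hits : (f : Cell → Fin m) → Unique (map f t) → ∀ i → ∃[ q ] (q ∈ t × i ≡ f q)
    hits f u i = ∈-map⁻ f (enumerates Fin._≟_ u ∈-allFin full i)
      where
      full : length (allFin m) ≤ length (map f t)
      full = ≤-reflexive (trans (length-allFin m) (sym (trans (length-map f t) length-t)))

    linked′ : ∀ {p q} → Arc x (expand x t) p q → Adj (LineGraph (K m)) p q
    linked′ pq with expand-arc⁻ pq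
    ... | a , b , ab , inj₁ (refl , refl) = row≢ (good ab) ∘ cong row , inj₂ (col a) , inj₂ refl , inj₂ refl
    ... | a , b , ab , inj₂ (refl , refl) = col≢ (good ab) ∘ cong col , inj₁ (row b) , inj₁ refl , inj₁ refl

    col-slot : ∀ {a b} → Arc x t a b → Slot x (expand x t) (inj₂ (col a)) a (link a b)
    col-slot ab = record { arc = expand-in ab ; src-on = inj₂ refl ; tgt-on = inj₂ refl ; unmatched = πsrc≢ (good ab) }

    row-slot : ∀ {a b} → Arc x t a b → Slot x (expand x t) (inj₁ (row b)) (link a b) b
    row-slot {a} {b} ab = record
      { arc = expand-out ab ; src-on = inj₁ refl ; tgt-on = inj₁ refl
      ; unmatched = λ e → πtgt≢ (good ab) (trans (cong π (sym e)) (π-involutive (link a b))) }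

    -- As `t` has m cells in distinct rows and columns, it meets every line. A row gets its slot
    -- from the arc into its cell of `t`, a column from the arc out of it.
    slots′ : ∀ v → ∃₂ λ p q → Slot x (expand x t) v p q
    slots′ (inj₁ r) with hits row rows r
    ... | _ , b∈t , refl = _ , _ , row-slot (proj₂ (predecessor b∈t))
    slots′ (inj₂ c) with hits col cols c
    ... | _ , a∈t , refl = _ , _ , col-slot (proj₂ (successor closed a∈t))

    slot-at : ∀ {y v} → y ∈ expand x t → On y v → ∃₂ λ p q → Slot x (expand x t) v p q × (p ≡ y ⊎ q ≡ y)
    slot-at y∈ yv with expand-∈⁻ y∈
    slot-at y∈ (inj₁ refl) | a , b , ab , inj₁ refl = _ , _ , row-slot ab , inj₁ refl
    slot-at y∈ (inj₂ refl) | a , b , ab , inj₁ refl = _ , _ , col-slot ab , inj₂ refl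
    slot-at y∈ (inj₁ refl) | a , b , ab , inj₂ refl = _ , _ , row-slot ab , inj₂ refl
    slot-at y∈ (inj₂ refl) | a , b , ab , inj₂ refl = _ , _ , col-slot (proj₂ (successor closed (Arc-target ab))) , inj₁ refl

    -- Assigns a cell to the arc whose column slot contains it, as `expand-∈⁻` does for row slots.
    by-source : ∀ {y} → y ∈ expand x t → ∃₂ λ a b → Arc x t a b × (y ≡ link a b ⊎ y ≡ a)
    by-source y∈ with expand-∈⁻ y∈
    ... | a , b , ab , inj₁ e    = a , b , ab , inj₁ e
    ... | a , b , ab , inj₂ refl with c , bc ← successor closed (Arc-target ab) = b , c , bc , inj₂ refl

    not-mates : ∀ {p q y} → π p ≢ q → y ≡ q ⊎ y ≡ p → ¬ (π y ≡ q ⊎ π y ≡ p)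
    not-mates ne (inj₁ refl) (inj₁ e) = π-≢ _ (sym e)
    not-mates ne (inj₁ refl) (inj₂ e) = ne (trans (cong π (sym e)) (π-involutive _))
    not-mates ne (inj₂ refl) (inj₁ e) = ne e
    not-mates ne (inj₂ refl) (inj₂ e) = π-≢ _ (sym e)

    same-col : ∀ {y a b} → y ≡ link a b ⊎ y ≡ a → col y ≡ col a
    same-col (inj₁ refl) = refl
    same-col (inj₂ refl) = refl

    same-row : ∀ {y a b} → y ≡ link a b ⊎ y ≡ b → row y ≡ row b
    same-row (inj₁ refl) = refl
    same-row (inj₂ refl) = refl

    -- Two expanded cells in one column belong to the same column slot, whose two cells are not
    -- matched. `row-mates` is the analogue for row slots; together they make `settled` vacuous at
    -- the start.
    col-mates : ∀ {y} → y ∈ expand x t → π y ∈ expand x t → col y ≢ col (π y)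
    col-mates y∈ πy∈ e with by-source y∈ | by-source πy∈
    ... | a , b , ab , ye | a′ , b′ , ab′ , πye
      with refl ← map-injective-on col cols (source-∈ closed ab) (source-∈ closed ab′)
                    (trans (sym (same-col {b = b} ye)) (trans e (same-col {b = b′} πye)))
      with refl ← target-unique closed t-unique ab ab′
      = not-mates (πsrc≢ (good ab)) ye πye

    row-mates : ∀ {y} → y ∈ expand x t → π y ∈ expand x t → row y ≢ row (π y)
    row-mates y∈ πy∈ e with expand-∈⁻ y∈ | expand-∈⁻ πy∈
    ... | a , b , ab , ye | a′ , b′ , ab′ , πye
      with refl ← map-injective-on row rows (Arc-target ab) (Arc-target ab′)
                    (trans (sym (same-row {a = a} ye)) (trans e (same-row {a = a′} πye)))
      with refl ← source-unique t-unique ab ab′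
      = not-mates (πtgt≢ (good ab)) ye πye

    no-mates : ∀ {y} → y ∈ expand x t → π y ∉ expand x t
    no-mates {y} y∈ πy∈ with mate-line y
    ... | inj₁ _ , inj₁ refl , inj₁ e = row-mates y∈ πy∈ (sym (inj₁-injective e))
    ... | inj₂ _ , inj₂ refl , inj₂ e = col-mates y∈ πy∈ (sym (inj₂-injective e))

    expanded : CellWalk x (expand x t)
    expanded = record
      { closed  = trans (expand-end x t) closed
      ; unique  = expand-unique good rows
      ; linked  = linked′
      ; slots   = slots′
      ; pending = λ y∈ _ yv _ → slot-at y∈ yv
      ; settled = λ y∈ πy∈ → contradiction πy∈ (no-mates y∈)
      }

  -- Inserting a cell into a slot

  module Insert {x : Cell} {t : List Cell} (W : CellWalk x t) {z : Cell} (z∉t : z ∉ t)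
                {v : Line} (zv : On z v) (πzv : On (π z) v)
                {p q : Cell} (s : Slot x t v p q) (beside-mate : π z ∈ t → π z ≡ p ⊎ π z ≡ q) where
    open CellWalk W
    open Slot s

    t′ : List Cell
    t′ = splice arc z

    p∈t : p ∈ t
    p∈t = source-∈ closed arc

    q∈t : q ∈ t
    q∈t = Arc-target arc

    p≢z : p ≢ z
    p≢z refl = z∉t p∈t

    z≢q : z ≢ q
    z≢q refl = z∉t q∈t

    p≢q : p ≢ q
    p≢q = proj₁ (linked arc)

    ∈-old : ∀ {y} → y ∈ t → y ∈ t′
    ∈-old y∈t = ∈-resp-↭ (↭-sym (splice-↭ arc)) (there y∈t)

    ∈-new : z ∈ t′
    ∈-new = ∈-resp-↭ (↭-sym (splice-↭ arc)) (here refl)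

    ∈-case : ∀ {y} → y ∈ t′ → y ≡ z ⊎ y ∈ t
    ∈-case y∈t′ with ∈-resp-↭ (splice-↭ arc) y∈t′
    ... | here e    = inj₁ e
    ... | there y∈t = inj₂ y∈t

    left-slot : π z ≢ p → Slot x t′ v p z
    left-slot πz≢p = record
      { arc = splice-left arc ; src-on = src-on ; tgt-on = zv
      ; unmatched = λ e → πz≢p (trans (cong π (sym e)) (π-involutive p)) }

    right-slot : π z ≢ q → Slot x t′ v z q
    right-slot πz≢q = record { arc = splice-right arc ; src-on = zv ; tgt-on = tgt-on ; unmatched = πz≢q }

    -- Both halves of the cut slot lie on `v`, and `π z` can equal only one of `p` and `q`, so one
    -- half is unmatched.
    new-slot : ∃₂ λ a b → Slot x t′ v a b
    new-slot with π z ≟ p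
    ... | yes πz≡p = z , q , right-slot (λ πz≡q → p≢q (trans (sym πz≡p) πz≡q))
    ... | no  πz≢p = p , z , left-slot πz≢p

    -- Only the slot on the cut arc is lost, and it belongs to no line but `v` because distinct
    -- cells share at most one line.
    old-slot : ∀ {w a b} → Slot x t w a b → (v ≡ w × a ≡ p × b ≡ q) ⊎ Slot x t′ w a b
    old-slot σ with splice-old arc (Slot.arc σ)
    ... | inj₁ (refl , refl) = inj₁ (line-unique p≢q src-on tgt-on (Slot.src-on σ) (Slot.tgt-on σ) , refl , refl)
    ... | inj₂ ab = inj₂ (record { arc = ab ; src-on = Slot.src-on σ ; tgt-on = Slot.tgt-on σ ; unmatched = Slot.unmatched σ })

    slots′ : ∀ w → ∃₂ λ a b → Slot x t′ w a b
    slots′ w with slots w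
    ... | a , b , σ with old-slot σ
    ...   | inj₁ (refl , _) = new-slot
    ...   | inj₂ σ′         = a , b , σ′

    linked′ : ∀ {a b} → Arc x t′ a b → Adj (LineGraph (K m)) a b
    linked′ ab with splice-new arc ab
    ... | inj₁ old                  = linked old
    ... | inj₂ (inj₁ (refl , refl)) = p≢z , v , src-on , zv
    ... | inj₂ (inj₂ (refl , refl)) = z≢q , v , zv , tgt-on

    pending′ : ∀ {y w} → y ∈ t′ → π y ∉ t′ → On y w → On (π y) w →
               ∃₂ λ a b → Slot x t′ w a b × (a ≡ y ⊎ b ≡ y)
    pending′ {y} y∈ πy∉ yw πyw with ∈-case y∈
    ... | inj₁ refl with refl ← line-unique (π-≢ z) zv πzv yw πyw =
      p , z , left-slot (λ e → πy∉ (∈-old (subst (_∈ t) (sym e) p∈t))) , inj₂ refl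
    ... | inj₂ y∈t with pending y∈t (πy∉ ∘ ∈-old) yw πyw
    ...   | a , b , σ , end with old-slot σ
    ...     | inj₂ σ′ = a , b , σ′ , end
    -- The slot reserved for `y` was the one cut, so `y` is `p` or `q`. Its partner is still absent
    -- while `z` is present, so the half next to `y` is again a slot.
    ...     | inj₁ (refl , refl , refl) = beside end
      where
      πz≢y : π z ≢ y
      πz≢y e = πy∉ (subst (_∈ t′) (trans (sym (π-involutive z)) (cong π e)) ∈-new)
      beside : p ≡ y ⊎ q ≡ y → ∃₂ λ a b → Slot x t′ v a b × (a ≡ y ⊎ b ≡ y)
      beside (inj₁ refl) = p , z , left-slot πz≢y , inj₁ refl
      beside (inj₂ refl) = z , q , right-slot πz≢y , inj₂ refl

    mate-arc : π z ∈ t → Arc x t′ z (π z) ⊎ Arc x t′ (π z) z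
    mate-arc πz∈t with beside-mate πz∈t
    ... | inj₁ e = inj₂ (subst (λ y → Arc x t′ y z) (sym e) (splice-left arc))
    ... | inj₂ e = inj₁ (subst (λ y → Arc x t′ z y) (sym e) (splice-right arc))

    settled′ : ∀ {y} → y ∈ t′ → π y ∈ t′ → Arc x t′ y (π y) ⊎ Arc x t′ (π y) y
    settled′ {y} y∈ πy∈ with ∈-case y∈ | ∈-case πy∈
    ... | inj₁ refl | inj₁ e    = contradiction (sym e) (π-≢ z)
    ... | inj₁ refl | inj₂ πz∈t = mate-arc πz∈t
    ... | inj₂ y∈t  | inj₁ refl = Sum.swap (subst (λ u → Arc x t′ (π y) u ⊎ Arc x t′ u (π y)) (π-involutive y)
                                    (mate-arc (subst (_∈ t) (sym (π-involutive y)) y∈t)))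
    ... | inj₂ y∈t  | inj₂ πy∈t with settled y∈t πy∈t
    ...   | inj₁ old with splice-old arc old
    ...     | inj₂ new        = inj₁ new
    -- The arc between two partners is never the one cut, since a slot is unmatched.
    ...     | inj₁ (refl , e) = contradiction e unmatched
    settled′ {y} y∈ πy∈ | inj₂ y∈t | inj₂ πy∈t | inj₂ old with splice-old arc old
    ...     | inj₂ new        = inj₂ new
    ...     | inj₁ (e , refl) = contradiction (trans (cong π (sym e)) (π-involutive y)) unmatched

    inserted : CellWalk x t′
    inserted = record
      { closed  = trans (splice-end arc) closed
      ; unique  = Unique-resp-↭ (↭-sym (splice-↭ arc)) (∉⇒All≢ z∉t ∷ unique)
      ; linked  = linked′
      ; slots   = slots′
      ; pending = pending′
      ; settled = settled′
      }

  -- If `π z` is absent, any slot on the common line serves. If it is present, it is itself pending,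
  -- because `z` is absent, and so has a slot beside it.
  insert : ∀ {x t} → CellWalk x t → ∀ z → z ∉ t → ∃[ t′ ] (t′ ↭ z ∷ t × CellWalk x t′)
  insert {t = t} W z z∉t with mate-line z | π z ∈? t
  ... | v , zv , πzv | no πz∉t with CellWalk.slots W v
  ...   | p , q , s = _ , splice-↭ (Slot.arc s) , Insert.inserted W z∉t zv πzv s (λ πz∈t → contradiction πz∈t πz∉t)
  insert {t = t} W z z∉t | v , zv , πzv | yes πz∈t
    with CellWalk.pending W πz∈t (z∉t ∘ subst (_∈ t) (π-involutive z)) πzv (subst (λ y → On y v) (sym (π-involutive z)) zv)
  ...   | p , q , s , beside =
    _ , splice-↭ (Slot.arc s) , Insert.inserted W z∉t zv πzv s (λ _ → Sum.map sym sym beside)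

  -- Filling the grid and reading off the Hamiltonian cycle

  fill : ∀ n {x t} → CellWalk x t → m * m ≤ n + length t → ∃[ t′ ] ((∀ y → y ∈ t′) × CellWalk x t′)
  -- `n` bounds the number of absent cells; at zero the walk is long enough to contain them all.
  fill zero {t = t} W le = t , enumerates _≟_ (CellWalk.unique W) (λ (a , b) → ∈-cartesianProduct⁺ (∈-allFin a) (∈-allFin b))
                                (subst (_≤ length t) (sym length-cells) le) , W
  fill (suc n) {t = t} W le with All.all? (_∈? t) cells
  ... | yes all = t , (λ (a , b) → All.lookup all (∈-cartesianProduct⁺ (∈-allFin a) (∈-allFin b))) , W
  ... | no ¬all = grow (find (¬All⇒Any¬ (_∈? t) cells ¬all))
    where
    grow : ∃[ z ] (z ∈ cells × z ∉ t) → ∃[ t′ ] ((∀ y → y ∈ t′) × CellWalk _ t′)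
    grow (z , _ , z∉t) with insert W z z∉t
    ... | t′ , t′↭ , W′ = fill n W′ (≤-trans le (≤-reflexive
            (trans (sym (+-suc n (length t))) (cong (n +_) (sym (↭-length t′↭))))))

  hamiltonian : ∀ {x t} → 2 ≤ m → (∀ y → y ∈ t) → CellWalk x t →
                ∃[ H ] (∀ v → CycleEdge {LineGraph (K m)} H v (π v))
  hamiltonian {x} {[]}     2≤m all W with () ← all x
  hamiltonian {x} {y ∷ ys} 2≤m all W = H , covered
    where
    open CellWalk W
    G : Graph
    G = LineGraph (K m)
    t : List Cell
    t = y ∷ ys
    last≡x : lookup t (fromℕ (length ys)) ≡ x
    last≡x = trans (lookup-end y ys) closed
    m²≤t : m * m ≤ length t
    m²≤t = subst (_≤ length t) length-cells (Unique-⊆-length cells-unique (λ {z} _ → all z))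
    H : HamiltonianCycle G
    H = record
      { k          = length ys
      ; long       = ≤-pred (≤-trans (≤-trans (n≤1+n 3) (*-mono-≤ 2≤m 2≤m)) m²≤t)
      ; c          = lookup t
      ; injective  = lookup-injective unique
      ; surjective = λ z → Any.index (all z) , sym (lookup-index (all z))
      ; step       = λ i → linked (there (arc-lookup y ys i))
      -- The first arc of the walk leaves `x`, which is also the last entry of `t`, so it is the
      -- closing edge.
      ; close      = subst (λ z → Adj G z y) (sym last≡x) (linked here)
      }
    forward : ∀ {u w} → Arc x t u w →
              (∃[ i ] (lookup t (inject₁ i) ≡ u × lookup ys i ≡ w)) ⊎ (lookup t (fromℕ (length ys)) ≡ u × y ≡ w)
    forward here       = inj₂ (last≡x , refl)
    forward (there uw) = inj₁ (arc-index uw)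
    covered : ∀ v → CycleEdge {G} H v (π v)
    covered v with settled (all v) (all (π v))
    ... | inj₁ a = Sum.map (λ (i , e) → i , inj₁ e) inj₁ (forward a)
    ... | inj₂ a = Sum.map (λ (i , e) → i , inj₂ e) inj₂ (forward a)

theorem5 : (m : ℕ) → 50 ≤ m → (∃[ t ] (m ≡ 2 * t)) → PMH (LineGraph (K m))
theorem5 m 50≤m _ M = assemble (compatible-cycle (≤-trans (m≤m+n 40 10) 50≤m))
  where
  open Grid M
  assemble : (∃₂ λ base x → ∃[ t ] (length t ≡ m × CompatibleWalk base x t)) →
             ∃[ H ] (∀ v → CycleEdge {LineGraph (K m)} H v (partner M v))
  assemble (_ , x , t , length-t , W) with fill (m * m) (Expand.expanded W length-t) (m≤m+n (m * m) _)
  ... | _ , all , W′ = hamiltonian (≤-trans (m≤m+n 2 48) 50≤m) all W′
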